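{- For every integer $d\ge 1$, $\hat{\delta}_{B_d}\ge\lfloor d/3\rfloor-1$.
   Context: $B_d$ is the complete binary tree of depth $d$, where depth is the number of vertices on a root-to-leaf path; thus $B_d$ has $2^d-1$ vertices and all its leaves are at the same level. For a finite graph $G$ and $1\le i\le|V(G)|$, $\delta(i,G)$ is the least number of edges in a cut $(X,\overline X)$ (the set of edges between $X$ and $V(G)\setminus X$) over all $X\subseteq V(G)$ with $|X|=i$. The edge isoperimetric peak of $G$ is $\hat\delta_G=\max_{1\le i\le|V(G)|}\delta(i,G)$. -}

module Defs where

open import Data.Bool.Base using (true; false)
open import Data.Fin.Base using (Fin; zero; suc; splitAt; join)
open import Data.Fin.Properties using (splitAt-join; join-splitAt)
open import Data.Fin.Subset using (Subset; inside; outside; ∁; ∣_∣)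
open import Data.Fin.Subset.Properties using (_∈?_)
open import Data.List.Base
  using (List; []; _∷_; _++_; map; filter; length; allFin; upTo; cartesianProduct)
open import Data.List.Extrema.Nat
  using (argmin; argmin-all; f[argmin]≤f[xs]; argmax-sel; max; xs≤max)
open import Data.List.Membership.Propositional.Properties
  using (∈-map⁺; ∈-map⁻; ∈-++⁺ˡ; ∈-++⁺ʳ; ∈-filter⁺; ∈-upTo⁺; ∈-upTo⁻)
open import Data.List.Relation.Unary.All.Properties using (all-filter)
open import Data.List.Relation.Unary.Any using (here)
open import Data.Nat.Base
  using (ℕ; zero; suc; pred; _+_; _∸_; _^_; _≤_; z≤n; s≤s)
open import Data.Nat.Properties using (_≟_; +-suc; +-identityʳ; n≤0⇒n≡0)
open import Data.Product.Base using (_×_; _,_; ∃-syntax)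
open import Data.Sum.Base using (_⊎_; inj₁; inj₂; [_,_]′; swap)
open import Data.Vec.Base using ([]; _∷_)
open import Function.Base using (_∘_; id)
open import Function.Bundles using (_↔_; mk↔ₛ′; module Inverse)
open import Level using (0ℓ)
open import Relation.Binary.Core using (Rel)
open import Relation.Binary.Definitions using (Decidable; Irreflexive; Symmetric)
open import Relation.Binary.PropositionalEquality
  using (_≡_; refl; sym; trans; cong; subst; module ≡-Reasoning)
open import Relation.Nullary.Decidable using (yes; no; _×-dec_; _⊎-dec_; map′)
open import Relation.Nullary.Negation using (¬_)

import Data.List.Membership.Propositional as List
import Data.List.Relation.Unary.All as All

-- The enumeration lets a set of vertices be represented as a
-- Subset order; the quantities below do not depend on its choice.
record Graph : Set₁ where
  field
    Vertex  : Set
    order   : ℕ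
    vertex  : Fin order ↔ Vertex
    Adj     : Rel Vertex 0ℓ
    adj?    : Decidable Adj
    symm    : Symmetric Adj
    irrefl  : Irreflexive _≡_ Adj

  _∼_ : Rel (Fin order) 0ℓ
  i ∼ j = Adj (Inverse.to vertex i) (Inverse.to vertex j)

  _∼?_ : Decidable _∼_
  i ∼? j = adj? (Inverse.to vertex i) (Inverse.to vertex j)

module _ (G : Graph) where
  open Graph G

  -- Each edge of the cut (X , ∁ X) is listed exactly once, directed
  -- from X to its complement.
  cut : Subset order → List (Fin order × Fin order)
  cut X = filter (λ (i , j) → i ∈? X ×-dec j ∈? ∁ X ×-dec i ∼? j)
                 (cartesianProduct (allFin order) (allFin order))

  cutSize : Subset order → ℕ
  cutSize X = length (cut X)

subsets : ∀ n → List (Subset n)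
subsets zero    = [] ∷ []
subsets (suc n) = map (inside ∷_) (subsets n) ++ map (outside ∷_) (subsets n)

subsetsOfSize : ∀ n → ℕ → List (Subset n)
subsetsOfSize n i = filter (λ X → ∣ X ∣ ≟ i) (subsets n)

initial : ∀ n → ℕ → Subset n
initial zero    i       = []
initial (suc n) zero    = outside ∷ initial n zero
initial (suc n) (suc i) = inside ∷ initial n i

module _ (G : Graph) where
  open Graph G

  -- The library's argmin needs a default candidate.  For i ≤ order, the
  -- default chosen here is itself a set of size i, so it does not affect
  -- the minimum; for i > order the value is meaningless (and never used).
  δ : ℕ → ℕ
  δ i = cutSize G (argmin (cutSize G) (initial order i) (subsetsOfSize order i))

  -- upTo starts at 0, hence the shift to 1 ≤ i ≤ order.
  peak : ℕ
  peak = max 0 (map (δ ∘ suc) (upTo order))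

∣initial∣ : ∀ {n i} → i ≤ n → ∣ initial n i ∣ ≡ i
∣initial∣ {zero}  z≤n       = refl
∣initial∣ {suc n} z≤n       = ∣initial∣ {n} z≤n
∣initial∣ {suc n} (s≤s i≤n) = cong suc (∣initial∣ i≤n)

∈-subsets : ∀ {n} (X : Subset n) → X List.∈ subsets n
∈-subsets []          = here refl
∈-subsets (true  ∷ X) = ∈-++⁺ˡ (∈-map⁺ _ (∈-subsets X))
∈-subsets (false ∷ X) = ∈-++⁺ʳ _ (∈-map⁺ _ (∈-subsets X))

module _ (G : Graph) where
  open Graph G

  δ-attained : ∀ {i} → i ≤ order → ∃[ X ] ∣ X ∣ ≡ i × cutSize G X ≡ δ G i
  δ-attained {i} i≤n =
    argmin (cutSize G) (initial order i) (subsetsOfSize order i)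
    , argmin-all (cutSize G) {P = λ X → ∣ X ∣ ≡ i} (∣initial∣ i≤n)
        (all-filter (λ X → ∣ X ∣ ≟ i) (subsets order))
    , refl

  δ-minimal : ∀ {i} (X : Subset order) → ∣ X ∣ ≡ i → δ G i ≤ cutSize G X
  δ-minimal {i} X ∣X∣≡i =
    All.lookup (f[argmin]≤f[xs] {f = cutSize G} (initial order i) (subsetsOfSize order i))
      (∈-filter⁺ (λ X → ∣ X ∣ ≟ i) (∈-subsets X) ∣X∣≡i)

  peak-maximal : ∀ {i} → 1 ≤ i → i ≤ order → δ G i ≤ peak G
  peak-maximal {suc i} (s≤s z≤n) i<n =
    All.lookup (xs≤max 0 (map (δ G ∘ suc) (upTo order)))
      (∈-map⁺ (δ G ∘ suc) (∈-upTo⁺ i<n))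

  peak-attained : 1 ≤ order → ∃[ i ] 1 ≤ i × i ≤ order × δ G i ≡ peak G
  peak-attained 1≤n = [ isDefault , isListed ]′ (argmax-sel id 0 δs)
    where
    δs : List ℕ
    δs = map (δ G ∘ suc) (upTo order)

    isDefault : peak G ≡ 0 → ∃[ i ] 1 ≤ i × i ≤ order × δ G i ≡ peak G
    isDefault peak≡0 =
      1 , s≤s z≤n , 1≤n
      , trans (n≤0⇒n≡0 (subst (δ G 1 ≤_) peak≡0 (peak-maximal (s≤s z≤n) 1≤n)))
              (sym peak≡0)

    isListed : peak G List.∈ δs → ∃[ i ] 1 ≤ i × i ≤ order × δ G i ≡ peak G
    isListed peak∈ =
      let i , i∈ , peak≡δ = ∈-map⁻ (δ G ∘ suc) peak∈
      in suc i , s≤s z≤n , ∈-upTo⁻ i∈ , sym peak≡δ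

-- A vertex is the path to it from the root; d bounds the number of
-- vertices on such a path, so that BVertex 0 is empty and BVertex 1 is
-- a single point.
data BVertex : ℕ → Set where
  root  : ∀ {d} → BVertex (suc d)
  left  : ∀ {d} → BVertex d → BVertex (suc d)
  right : ∀ {d} → BVertex d → BVertex (suc d)

-- Parent u v: u is the parent of v.
data Parent : ∀ {d} → BVertex d → BVertex d → Set where
  root-left  : ∀ {d} → Parent {suc (suc d)} root (left root)
  root-right : ∀ {d} → Parent {suc (suc d)} root (right root)
  left       : ∀ {d} {u v : BVertex d} → Parent u v → Parent (left u) (left v)
  right      : ∀ {d} {u v : BVertex d} → Parent u v → Parent (right u) (right v)

parent? : ∀ {d} → Decidable (Parent {d})
parent? root      root              = no λ ()
parent? root      (left root)       = yes root-left
parent? root      (left (left _))   = no λ ()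
parent? root      (left (right _))  = no λ ()
parent? root      (right root)      = yes root-right
parent? root      (right (left _))  = no λ ()
parent? root      (right (right _)) = no λ ()
parent? (left _)  root              = no λ ()
parent? (left u)  (left v)          = map′ left (λ { (left p) → p }) (parent? u v)
parent? (left _)  (right _)         = no λ ()
parent? (right _) root              = no λ ()
parent? (right _) (left _)          = no λ ()
parent? (right u) (right v)         = map′ right (λ { (right p) → p }) (parent? u v)

parent-irrefl : ∀ {d} {u : BVertex d} → ¬ Parent u u
parent-irrefl (left p)  = parent-irrefl p
parent-irrefl (right p) = parent-irrefl p

size : ℕ → ℕ
size zero    = 0
size (suc d) = suc (size d + size d)

size≡2^d∸1 : ∀ d → size d ≡ 2 ^ d ∸ 1
size≡2^d∸1 d = cong pred (suc-size d)
  where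
  suc-size : ∀ d → suc (size d) ≡ 2 ^ d
  suc-size zero    = refl
  suc-size (suc d) = begin
    suc (suc (size d + size d))  ≡⟨ cong suc (+-suc (size d) (size d)) ⟨
    suc (size d) + suc (size d)  ≡⟨ cong (λ k → k + k) (suc-size d) ⟩
    2 ^ d + 2 ^ d                ≡⟨ cong (2 ^ d +_) (+-identityʳ (2 ^ d)) ⟨
    2 ^ suc d                    ∎
    where open ≡-Reasoning

toVertex : ∀ d → Fin (size d) → BVertex d
toVertex (suc d) zero    = root
toVertex (suc d) (suc i) =
  [ left ∘ toVertex d , right ∘ toVertex d ]′ (splitAt (size d) i)

fromVertex : ∀ d → BVertex d → Fin (size d)
fromVertex (suc d) root      = zero
fromVertex (suc d) (left v)  = suc (join (size d) (size d) (inj₁ (fromVertex d v)))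
fromVertex (suc d) (right v) = suc (join (size d) (size d) (inj₂ (fromVertex d v)))

to∘from : ∀ d v → toVertex d (fromVertex d v) ≡ v
to∘from (suc d) root = refl
to∘from (suc d) (left v)
  rewrite splitAt-join (size d) (size d) (inj₁ (fromVertex d v)) = cong left (to∘from d v)
to∘from (suc d) (right v)
  rewrite splitAt-join (size d) (size d) (inj₂ (fromVertex d v)) = cong right (to∘from d v)

from∘to : ∀ d i → fromVertex d (toVertex d i) ≡ i
from∘to (suc d) zero = refl
from∘to (suc d) (suc i)
  with splitAt (size d) i | join-splitAt (size d) (size d) i
... | inj₁ j | eq rewrite from∘to d j = cong suc eq
... | inj₂ j | eq rewrite from∘to d j = cong suc eq

B : ℕ → Graph
B d = record
  { Vertex = BVertex d
  ; order  = size d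
  ; vertex = mk↔ₛ′ (toVertex d) (fromVertex d) (to∘from d) (from∘to d)
  ; Adj    = λ u v → Parent u v ⊎ Parent v u
  ; adj?   = λ u v → parent? u v ⊎-dec parent? v u
  ; symm   = swap
  ; irrefl = λ { refl → [ parent-irrefl , parent-irrefl ]′ }
  }

{-# OPTIONS --safe #-}

-- A vertex of B_d whose colour (in X or not) differs from that of its parent
-- changes |X| by the size 2^h − 1 of its subtree.  Hence a cut of size k writes
-- |X| as a signed sum of at most k + 1 numbers 2^h − 1 (the extra one comes from
-- the root), and |X| + a, for some |a| ≤ k + 1, as a signed sum of at most k + 1
-- powers of two.  With M = ⌊d/3⌋, take |X| = 2^M q + M, where q = 0101…01 in
-- binary (2M digits).  The M low digits absorb the error a, and each block 01
-- of q costs one signed power of two; so k + 1 ≥ M.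
module Submission where

open import Defs
open import Data.Bool.Base using (Bool; true; false)
open import Data.Fin.Subset using (Subset) renaming (∣_∣ to card)
open import Data.Fin.Subset.Properties using (x∉p⇒x∈∁p)
open import Data.Integer using (+_; _-_) renaming (_≤_ to _≤ℤ_)
open import Data.Integer
  using (ℤ; -[1+_]; 0ℤ; 1ℤ; ∣_∣; +≤+; -≤+; _^_)
  renaming (_+_ to _+ℤ_; _*_ to _*ℤ_)
open import Data.Integer.Tactic.RingSolver using (solve-∀)
open import Data.List.Base using (List; []; _∷_; _++_; map; length)
open import Data.List.Membership.Propositional using (_∈_)
open import Data.List.Membership.Propositional.Properties
  using (∈-∃++; ∈-++⁻; ∈-++⁺ˡ; ∈-++⁺ʳ; ∈-filter⁺; ∈-cartesianProduct⁺; ∈-allFin)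
open import Data.List.Properties using (length-++; length-map)
open import Data.List.Relation.Binary.Disjoint.Propositional using (Disjoint)
open import Data.List.Relation.Unary.All using (All; []; _∷_)
open import Data.List.Relation.Unary.AllPairs using ([]; _∷_)
open import Data.List.Relation.Unary.Any using (here; there)
open import Data.List.Relation.Unary.Unique.Propositional using (Unique)
open import Data.Nat using (ℕ; _≤_; _/_)
open import Data.Nat using (zero; suc; _+_; _*_; _∸_; z≤n; s≤s) renaming (_^_ to _^ℕ_)
open import Data.Nat.DivMod using (m/n*n≤m)
open import Data.Nat.Properties
open import Data.Product.Base using (_×_; _,_; proj₁; proj₂; ∃-syntax)
open import Data.Product.Properties using (,-injectiveˡ; ,-injectiveʳ)
open import Data.Sum.Base using (_⊎_; inj₁; inj₂; [_,_]′)
open import Data.Vec.Base using (lookup; splitAt) renaming (_∷_ to _∷ᵥ_; _++_ to _++ᵥ_; [] to []ᵥ)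
open import Data.Vec.Properties using (lookup-++ˡ; lookup-++ʳ; lookup⇒[]=; []=⇒lookup)
open import Function.Base using (_∘_; case_of_)
open import Relation.Binary.PropositionalEquality
open import Relation.Nullary.Negation using (¬_)

import Data.Integer.Properties as ℤ
import Data.List.Relation.Unary.All as All
import Data.List.Relation.Unary.All.Properties as All
import Data.List.Relation.Unary.Unique.Propositional.Properties as Unique
import Data.Sum.Base as Sum

-- Signed sums of powers of two

-- The pair (c , h) stands for the multiple c · f h, for various f.
Combination : Set
Combination = List (ℤ × ℕ)

evaluate : (ℕ → ℤ) → Combination → ℤ
evaluate f []             = 0ℤ
evaluate f ((c , h) ∷ ts) = c *ℤ f h +ℤ evaluate f ts

cost : Combination → ℕ
cost []             = 0
cost ((c , _) ∷ ts) = ∣ c ∣ + cost ts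

pow : ℕ → ℤ
pow h = (+ 2) ^ h

pow≡+2^ : ∀ l → pow l ≡ + (2 ^ℕ l)
pow≡+2^ zero    = refl
pow≡+2^ (suc l) = trans (cong (+ 2 *ℤ_) (pow≡+2^ l)) (sym (ℤ.pos-* 2 (2 ^ℕ l)))

evaluate-++ : ∀ f ts us → evaluate f (ts ++ us) ≡ evaluate f ts +ℤ evaluate f us
evaluate-++ f []             us = sym (ℤ.+-identityˡ _)
evaluate-++ f ((c , h) ∷ ts) us =
  trans (cong (c *ℤ f h +ℤ_) (evaluate-++ f ts us)) (sym (ℤ.+-assoc (c *ℤ f h) _ _))

cost-++ : ∀ ts us → cost (ts ++ us) ≡ cost ts + cost us
cost-++ []             us = refl
cost-++ ((c , h) ∷ ts) us =
  trans (cong (λ n → ∣ c ∣ + n) (cost-++ ts us)) (sym (+-assoc ∣ c ∣ _ _))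

-- The change in value when every weight 2^h - 1 is replaced by 2^h: the error `a` of the overview.
coefficientSum : Combination → ℤ
coefficientSum = evaluate (λ _ → 1ℤ)

∣coefficientSum∣≤cost : ∀ ts → ∣ coefficientSum ts ∣ ≤ cost ts
∣coefficientSum∣≤cost []             = z≤n
∣coefficientSum∣≤cost ((c , h) ∷ ts) rewrite ℤ.*-identityʳ c =
  ≤-trans (ℤ.∣i+j∣≤∣i∣+∣j∣ c _) (+-monoʳ-≤ ∣ c ∣ (∣coefficientSum∣≤cost ts))

1+size≡pow : ∀ h → 1ℤ +ℤ + size h ≡ pow h
1+size≡pow zero    = refl
1+size≡pow (suc h) = trans (lemma (+ size h)) (cong (+ 2 *ℤ_) (1+size≡pow h))
  where
  lemma : ∀ s → 1ℤ +ℤ (1ℤ +ℤ (s +ℤ s)) ≡ + 2 *ℤ (1ℤ +ℤ s)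
  lemma = solve-∀

evaluate-pow : ∀ ts → evaluate pow ts ≡ evaluate (+_ ∘ size) ts +ℤ coefficientSum ts
evaluate-pow []             = refl
evaluate-pow ((c , h) ∷ ts) = begin
  c *ℤ pow h +ℤ evaluate pow ts
    ≡⟨ cong₂ (λ p e → c *ℤ p +ℤ e) (sym (1+size≡pow h)) (evaluate-pow ts) ⟩
  c *ℤ (1ℤ +ℤ + size h) +ℤ (evaluate (+_ ∘ size) ts +ℤ coefficientSum ts)
    ≡⟨ lemma c (+ size h) (evaluate (+_ ∘ size) ts) (coefficientSum ts) ⟩
  (c *ℤ + size h +ℤ evaluate (+_ ∘ size) ts) +ℤ (c *ℤ 1ℤ +ℤ coefficientSum ts) ∎
  where
  open ≡-Reasoning
  lemma : ∀ c s e a → c *ℤ (1ℤ +ℤ s) +ℤ (e +ℤ a) ≡ (c *ℤ s +ℤ e) +ℤ (c *ℤ 1ℤ +ℤ a)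
  lemma = solve-∀

-- The terms with exponent 0 are added up into `c`, and all other exponents drop by one.
-- Coefficients are otherwise left alone, so `c` need not be 0 or ±1.
halve : ∀ ts → ∃[ c ] ∃[ us ]
  evaluate pow ts ≡ c +ℤ + 2 *ℤ evaluate pow us × ∣ c ∣ + cost us ≤ cost ts
halve [] = 0ℤ , [] , refl , z≤n
halve ((c , zero) ∷ ts) =
  let e , us , value , bound = halve ts in
  c +ℤ e , us
  , trans (cong (c *ℤ 1ℤ +ℤ_) value) (lemma c e (evaluate pow us))
  , (begin
      ∣ c +ℤ e ∣ + cost us       ≤⟨ +-monoˡ-≤ (cost us) (ℤ.∣i+j∣≤∣i∣+∣j∣ c e) ⟩
      ∣ c ∣ + ∣ e ∣ + cost us    ≡⟨ +-assoc ∣ c ∣ ∣ e ∣ (cost us) ⟩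
      ∣ c ∣ + (∣ e ∣ + cost us)  ≤⟨ +-monoʳ-≤ ∣ c ∣ bound ⟩
      ∣ c ∣ + cost ts            ∎)
  where
  open ≤-Reasoning
  lemma : ∀ c e v → c *ℤ 1ℤ +ℤ (e +ℤ + 2 *ℤ v) ≡ (c +ℤ e) +ℤ + 2 *ℤ v
  lemma = solve-∀
halve ((c , suc h) ∷ ts) =
  let e , us , value , bound = halve ts in
  e , (c , h) ∷ us
  , trans (cong (c *ℤ pow (suc h) +ℤ_) value) (lemma c e (pow h) (evaluate pow us))
  , (begin
      ∣ e ∣ + (∣ c ∣ + cost us)  ≡⟨ +-assoc ∣ e ∣ ∣ c ∣ (cost us) ⟨
      ∣ e ∣ + ∣ c ∣ + cost us    ≡⟨ cong (_+ cost us) (+-comm ∣ e ∣ ∣ c ∣) ⟩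
      ∣ c ∣ + ∣ e ∣ + cost us    ≡⟨ +-assoc ∣ c ∣ ∣ e ∣ (cost us) ⟩
      ∣ c ∣ + (∣ e ∣ + cost us)  ≤⟨ +-monoʳ-≤ ∣ c ∣ bound ⟩
      ∣ c ∣ + cost ts            ∎)
  where
  open ≤-Reasoning
  lemma : ∀ c e p v → c *ℤ (+ 2 *ℤ p) +ℤ (e +ℤ + 2 *ℤ v) ≡ e +ℤ + 2 *ℤ (c *ℤ p +ℤ v)
  lemma = solve-∀

-- Costly m p implies that p is not a signed sum of fewer than m powers of two.  The
-- distance term is what lets the property be transported along halve, where an
-- arbitrarily large coefficient may have to be carried.
Costly : ℕ → ℤ → Set
Costly m p = ∀ ts → m ≤ cost ts + ∣ evaluate pow ts - p ∣

costly-mono : ∀ {m m′ p} → m ≤ m′ → Costly m′ p → Costly m p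
costly-mono m≤m′ costly ts = ≤-trans m≤m′ (costly ts)

∣j∣≤∣i∣+∣i+j∣ : ∀ i j → ∣ j ∣ ≤ ∣ i ∣ + ∣ i +ℤ j ∣
∣j∣≤∣i∣+∣i+j∣ i j = begin
  ∣ j ∣                 ≡⟨ cong ∣_∣ (lemma i j) ⟩
  ∣ (i +ℤ j) - i ∣      ≤⟨ ℤ.∣i-j∣≤∣i∣+∣j∣ (i +ℤ j) i ⟩
  ∣ i +ℤ j ∣ + ∣ i ∣    ≡⟨ +-comm ∣ i +ℤ j ∣ ∣ i ∣ ⟩
  ∣ i ∣ + ∣ i +ℤ j ∣    ∎
  where
  open ≤-Reasoning
  lemma : ∀ i j → j ≡ (i +ℤ j) - i
  lemma = solve-∀

-- The carried unit coefficient `c` can bring the value closer to `p` by at most ∣c∣, and exactly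
-- that amount has been paid in the cost. Hence only the distance with `c` left out, `g v`, has to
-- be bounded.
costly-halve : ∀ {m p} (g : ℤ → ℤ) → (∀ c v → (c +ℤ + 2 *ℤ v) - p ≡ c +ℤ g v) →
               (∀ us → m ≤ cost us + ∣ g (evaluate pow us) ∣) → Costly m p
costly-halve {m} {p} g shift costly ts =
  let c , us , value , bound = halve ts
      v = evaluate pow us
  in begin
    m                                        ≤⟨ costly us ⟩
    cost us + ∣ g v ∣                        ≤⟨ +-monoʳ-≤ (cost us) (∣j∣≤∣i∣+∣i+j∣ c (g v)) ⟩
    cost us + (∣ c ∣ + ∣ c +ℤ g v ∣)         ≡⟨ +-assoc (cost us) ∣ c ∣ _ ⟨
    cost us + ∣ c ∣ + ∣ c +ℤ g v ∣           ≡⟨ cong (_+ ∣ c +ℤ g v ∣) (+-comm (cost us) ∣ c ∣) ⟩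
    ∣ c ∣ + cost us + ∣ c +ℤ g v ∣           ≤⟨ +-monoˡ-≤ _ bound ⟩
    cost ts + ∣ c +ℤ g v ∣                   ≡⟨ cong (λ x → cost ts + ∣ x ∣) (shift c v) ⟨
    cost ts + ∣ (c +ℤ + 2 *ℤ v) - p ∣        ≡⟨ cong (λ x → cost ts + ∣ x - p ∣) value ⟨
    cost ts + ∣ evaluate pow ts - p ∣        ∎
  where open ≤-Reasoning

costly-even : ∀ {m p} → Costly m p → Costly m (+ 2 *ℤ p)
costly-even {m} {p} costly = costly-halve (λ v → + 2 *ℤ (v - p)) (lemma p) λ us →
  ≤-trans (costly us) (+-monoʳ-≤ (cost us)
    (≤-trans (m≤m+n _ _) (≤-reflexive (sym (ℤ.abs-* (+ 2) (evaluate pow us - p))))))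
  where
  lemma : ∀ p c v → (c +ℤ + 2 *ℤ v) - + 2 *ℤ p ≡ c +ℤ + 2 *ℤ (v - p)
  lemma = solve-∀

-- The integers i and i - 1 never have opposite signs, so the absolute value of their sum is ∣i∣ +
-- ∣i - 1∣, and at least one of the two is nonzero.
∣2i-1∣-bound : ∀ i → suc ∣ i ∣ ≤ ∣ i +ℤ (i - 1ℤ) ∣ ⊎ suc ∣ i - 1ℤ ∣ ≤ ∣ i +ℤ (i - 1ℤ) ∣
∣2i-1∣-bound (+ zero)  = inj₁ ≤-refl
∣2i-1∣-bound (+ suc n) = inj₂ (s≤s (m≤n+m n n))
∣2i-1∣-bound -[1+ n ]  = inj₁ (s≤s (s≤s (m≤m+n n _)))

-- With i = v - p, the distance from 2v to 2p + 1 is ∣2i - 1∣, which strictly exceeds the distance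
-- from v to p or to p + 1. The hypothesis on that neighbour then gains one unit.
costly-odd : ∀ {m p} → Costly m p → Costly m (1ℤ +ℤ p) → Costly (suc m) (1ℤ +ℤ + 2 *ℤ p)
costly-odd {m} {p} costly costly⁺ =
  costly-halve (λ v → (v - p) +ℤ ((v - p) - 1ℤ)) (lemma p) λ us →
    let v = evaluate pow us in
    [ (λ le → via us (costly us) le)
    , (λ le → via us (subst (λ x → m ≤ cost us + ∣ x ∣) (lemma⁺ p v) (costly⁺ us)) le)
    ]′ (∣2i-1∣-bound (v - p))
  where
  via : ∀ us {a b} → m ≤ cost us + a → suc a ≤ b → suc m ≤ cost us + b
  via us {a} {b} m≤ a<b = begin
    suc m                ≤⟨ s≤s m≤ ⟩
    suc (cost us + a)    ≡⟨ +-suc (cost us) a ⟨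
    cost us + suc a      ≤⟨ +-monoʳ-≤ (cost us) a<b ⟩
    cost us + b          ∎
    where open ≤-Reasoning
  lemma : ∀ p c v → (c +ℤ + 2 *ℤ v) - (1ℤ +ℤ + 2 *ℤ p) ≡ c +ℤ ((v - p) +ℤ ((v - p) - 1ℤ))
  lemma = solve-∀
  lemma⁺ : ∀ p v → v - (1ℤ +ℤ p) ≡ (v - p) - 1ℤ
  lemma⁺ = solve-∀

costly-even⁺ : ∀ {m p} → Costly m (1ℤ +ℤ p) → Costly m (1ℤ +ℤ (1ℤ +ℤ + 2 *ℤ p))
costly-even⁺ {m} {p} costly⁺ = subst (Costly m) (lemma p) (costly-even costly⁺)
  where
  lemma : ∀ p → + 2 *ℤ (1ℤ +ℤ p) ≡ 1ℤ +ℤ (1ℤ +ℤ + 2 *ℤ p)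
  lemma = solve-∀

-- Appending binary digits never makes a costly consecutive pair cheaper: p, p + 1 passes to 2p, 2p
-- + 1 or to 2p + 1, 2p + 2. The closed range for `r` covers both members of the final pair.
costly-append : ∀ {m p} → Costly m p → Costly m (1ℤ +ℤ p) →
                ∀ l {r} → r ≤ 2 ^ℕ l → Costly m (pow l *ℤ p +ℤ + r)
costly-append {m} {p} costly costly⁺ zero z≤n =
  subst (Costly m) (lemma p) costly
  where
  lemma : ∀ p → p ≡ 1ℤ *ℤ p +ℤ 0ℤ
  lemma = solve-∀
costly-append {m} {p} costly costly⁺ zero (s≤s z≤n) =
  subst (Costly m) (lemma p) costly⁺
  where
  lemma : ∀ p → 1ℤ +ℤ p ≡ 1ℤ *ℤ p +ℤ 1ℤ
  lemma = solve-∀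
-- The leading digit of `r` decides which of the two pairs to continue with.
costly-append {m} {p} costly costly⁺ (suc l) {r} r≤ = case ≤-total r (2 ^ℕ l) of λ where
    (inj₁ r≤2^l) → subst (Costly m) (lower (pow l) p (+ r))
      (costly-append (costly-even costly) odd l r≤2^l)
    (inj₂ 2^l≤r) → let s , r≡ = m≤n⇒∃[o]m+o≡n 2^l≤r in
      subst (Costly m) (upper s r≡)
        (costly-append odd (costly-even⁺ {p = p} costly⁺) l (s≤2^l s r≡))
  where
  odd : Costly m (1ℤ +ℤ + 2 *ℤ p)
  odd = costly-mono {p = 1ℤ +ℤ + 2 *ℤ p} (n≤1+n m) (costly-odd costly costly⁺)
  s≤2^l : ∀ s → 2 ^ℕ l + s ≡ r → s ≤ 2 ^ℕ l
  s≤2^l s r≡ = +-cancelˡ-≤ (2 ^ℕ l) s (2 ^ℕ l)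
    (subst₂ _≤_ (sym r≡) (cong (λ n → 2 ^ℕ l + n) (+-identityʳ _)) r≤)
  lower : ∀ a p r → a *ℤ (+ 2 *ℤ p) +ℤ r ≡ + 2 *ℤ a *ℤ p +ℤ r
  lower = solve-∀
  regroup : ∀ a p s → a *ℤ (1ℤ +ℤ + 2 *ℤ p) +ℤ s ≡ + 2 *ℤ a *ℤ p +ℤ (a +ℤ s)
  regroup = solve-∀
  upper : ∀ s → 2 ^ℕ l + s ≡ r →
          pow l *ℤ (1ℤ +ℤ + 2 *ℤ p) +ℤ + s ≡ pow (suc l) *ℤ p +ℤ + r
  upper s r≡ = trans (regroup (pow l) p (+ s))
    (cong (pow (suc l) *ℤ p +ℤ_) (trans (cong (_+ℤ + s) (pow≡+2^ l)) (cong +_ r≡)))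

-- The number q of the header: binary digits 0101…01, 2m of them.
alternating : ℕ → ℕ
alternating zero    = 0
alternating (suc m) = suc (2 * (2 * alternating m))

alternating< : ∀ m → suc (alternating m) ≤ 2 ^ℕ (m + m)
alternating< zero    = ≤-refl
alternating< (suc m) rewrite +-suc m m = begin
  suc (suc (2 * (2 * a)))  ≤⟨ m≤n+m _ 2 ⟩
  4 + 2 * (2 * a)          ≡⟨ cong (λ n → 2 + n) (*-suc 2 (2 * a)) ⟨
  2 + 2 * suc (2 * a)      ≡⟨ *-suc 2 (suc (2 * a)) ⟨
  2 * suc (suc (2 * a))    ≡⟨ cong (2 *_) (*-suc 2 a) ⟨
  2 * (2 * suc a)          ≤⟨ *-monoʳ-≤ 2 (*-monoʳ-≤ 2 (alternating< m)) ⟩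
  2 * (2 * 2 ^ℕ (m + m))   ∎
  where
  open ≤-Reasoning
  a = alternating m

-- The induction carries a consecutive pair a, a + 1. One digit makes only 2a + 1 dearer; after the
-- second, 4a + 1 is dearer as an odd number between the doubles of 2a and 2a + 1, and 4a + 2 as the
-- double of 2a + 1.
costly-alternating : ∀ m →
  Costly m (+ alternating m) × Costly m (1ℤ +ℤ + alternating m)
costly-alternating zero    = (λ _ → z≤n) , (λ _ → z≤n)
costly-alternating (suc m) =
    subst (Costly (suc m)) (sym value) odd-even
  , subst (Costly (suc m)) (cong (1ℤ +ℤ_) (sym value)) even-odd
  where
  a    = + alternating m
  costly  = proj₁ (costly-alternating m)
  costly⁺ = proj₂ (costly-alternating m)
  odd : Costly (suc m) (1ℤ +ℤ + 2 *ℤ a)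
  odd = costly-odd costly costly⁺
  odd-even : Costly (suc m) (1ℤ +ℤ + 2 *ℤ (+ 2 *ℤ a))
  odd-even = costly-odd (costly-even costly) (costly-mono {p = 1ℤ +ℤ + 2 *ℤ a} (n≤1+n m) odd)
  even-odd : Costly (suc m) (1ℤ +ℤ (1ℤ +ℤ + 2 *ℤ (+ 2 *ℤ a)))
  even-odd = costly-even⁺ {p = + 2 *ℤ a} odd
  value : + alternating (suc m) ≡ 1ℤ +ℤ + 2 *ℤ (+ 2 *ℤ a)
  value = cong (1ℤ +ℤ_) (trans (ℤ.pos-* 2 (2 * alternating m)) (cong (+ 2 *ℤ_) (ℤ.pos-* 2 (alternating m))))

-- The critical size

n<2^n : ∀ n → suc n ≤ 2 ^ℕ n
n<2^n zero    = ≤-refl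
n<2^n (suc n) = ≤-trans (+-mono-≤ (m^n>0 2 n) (n<2^n n))
  (≤-reflexive (cong (λ k → 2 ^ℕ n + k) (sym (+-identityʳ _))))

n+n≤2^n : ∀ n → n + n ≤ 2 ^ℕ n
n+n≤2^n zero    = z≤n
n+n≤2^n (suc n) =
  ≤-trans (+-mono-≤ (n<2^n n) (n<2^n n))
    (≤-reflexive (cong (λ k → 2 ^ℕ n + k) (sym (+-identityʳ _))))

-- The summand `m` centres the low part: an error between -m and m moves it within 0 to 2m, so
-- nothing is borrowed from the digits of `alternating m`.
criticalSize : ℕ → ℕ
criticalSize m = 2 ^ℕ m * alternating m + m

-- The m low digits and the 2m alternating ones together need depth 3m; this is the source of the
-- divisor 3 in the theorem.
criticalSize≤size : ∀ m → criticalSize m ≤ size (3 * m)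
criticalSize≤size m = ≤-pred (begin
  suc (2 ^ℕ m * a + m)     ≡⟨ +-suc (2 ^ℕ m * a) m ⟨
  2 ^ℕ m * a + suc m       ≤⟨ +-monoʳ-≤ (2 ^ℕ m * a) (n<2^n m) ⟩
  2 ^ℕ m * a + 2 ^ℕ m      ≡⟨ +-comm (2 ^ℕ m * a) (2 ^ℕ m) ⟩
  2 ^ℕ m + 2 ^ℕ m * a      ≡⟨ *-suc (2 ^ℕ m) a ⟨
  2 ^ℕ m * suc a           ≤⟨ *-monoʳ-≤ (2 ^ℕ m) (alternating< m) ⟩
  2 ^ℕ m * 2 ^ℕ (m + m)    ≡⟨ ^-distribˡ-+-* 2 m (m + m) ⟨
  2 ^ℕ (m + (m + m))       ≡⟨ cong (λ k → 2 ^ℕ (m + (m + k))) (+-identityʳ m) ⟨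
  2 ^ℕ (3 * m)             ≡⟨ ℤ.+-injective (trans (1+size≡pow (3 * m)) (pow≡+2^ (3 * m))) ⟨
  suc (size (3 * m))       ∎)
  where
  open ≤-Reasoning
  a = alternating m

size-mono : ∀ {m n} → m ≤ n → size m ≤ size n
size-mono z≤n       = z≤n
size-mono (s≤s m≤n) = s≤s (+-mono-≤ (size-mono m≤n) (size-mono m≤n))

+-nonNegative : ∀ m a → ∣ a ∣ ≤ m → ∃[ r ] r ≤ m + m × + m +ℤ a ≡ + r
+-nonNegative m (+ k)    k≤m = m + k , +-monoʳ-≤ m k≤m , refl
+-nonNegative m -[1+ k ] k<m =
  m ∸ suc k , ≤-trans (m∸n≤m m (suc k)) (m≤m+n m m) , ℤ.⊖-≥ k<m

costly-criticalSize : ∀ m a → ∣ a ∣ ≤ m → Costly m (+ criticalSize m +ℤ a)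
costly-criticalSize m a ∣a∣≤m =
  let r , r≤ , value = +-nonNegative m a ∣a∣≤m
      costly , costly⁺ = costly-alternating m
  in subst (Costly m) (shift r value)
       -- The low part `r` is at most 2m, hence at most 2^m; for m = 1 and m = 2 the endpoint 2^m
       -- can be reached.
       (costly-append costly costly⁺ m (≤-trans r≤ (n+n≤2^n m)))
  where
  open ≡-Reasoning
  shift : ∀ r → + m +ℤ a ≡ + r →
          pow m *ℤ + alternating m +ℤ + r ≡ + criticalSize m +ℤ a
  shift r value = begin
    pow m *ℤ + alternating m +ℤ + r
      ≡⟨ cong₂ (λ p s → p *ℤ + alternating m +ℤ s) (pow≡+2^ m) (sym value) ⟩
    + (2 ^ℕ m) *ℤ + alternating m +ℤ (+ m +ℤ a)
      ≡⟨ cong (_+ℤ (+ m +ℤ a)) (ℤ.pos-* (2 ^ℕ m) (alternating m)) ⟨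
    + (2 ^ℕ m * alternating m) +ℤ (+ m +ℤ a)
      ≡⟨ ℤ.+-assoc (+ (2 ^ℕ m * alternating m)) (+ m) a ⟨
    + criticalSize m +ℤ a ∎

cost-criticalSize : ∀ m ts → evaluate (+_ ∘ size) ts ≡ + criticalSize m → m ≤ cost ts
cost-criticalSize m ts value = case ≤-total m (cost ts) of λ where
    (inj₁ m≤cost) → m≤cost
    -- Here the error is at most `m`, and `ts` evaluates exactly to the shifted target, so the
    -- distance term of `Costly` vanishes.
    (inj₂ cost≤m) → ≤-trans
      (costly-criticalSize m a (≤-trans (∣coefficientSum∣≤cost ts) cost≤m) ts)
      (≤-reflexive (trans (cong (λ d → cost ts + ∣ d ∣) difference) (+-identityʳ _)))
  where
  a = coefficientSum ts
  difference : evaluate pow ts - (+ criticalSize m +ℤ a) ≡ 0ℤ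
  difference = ℤ.i≡j⇒i-j≡0 (trans (evaluate-pow ts) (cong (_+ℤ a) value))

-- Colourings of the binary tree

indicator : Bool → ℕ
indicator true  = 1
indicator false = 0

count : ∀ d → (BVertex d → Bool) → ℕ
count zero    χ = 0
count (suc d) χ = indicator (χ root) + (count d (χ ∘ left) + count d (χ ∘ right))

jump : Bool → Bool → ℤ
jump b c = + indicator c - + indicator b

-- The argument `b` is the colour of the parent, possibly an imaginary one. Monochromatic edges stay
-- in the list with coefficient 0, at no cost.
jumps : ∀ d → Bool → (BVertex d → Bool) → Combination
jumps zero    b χ = []
jumps (suc d) b χ =
  (jump b (χ root) , suc d) ∷ jumps d (χ root) (χ ∘ left) ++ jumps d (χ root) (χ ∘ right)

-- Start with the whole tree coloured `b` and work downwards: each change of colour recolours an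
-- entire subtree, changing the count by plus or minus its size.
evaluate-jumps : ∀ d b χ →
  evaluate (+_ ∘ size) (jumps d b χ) +ℤ + indicator b *ℤ + size d ≡ + count d χ
evaluate-jumps zero    b χ = trans (ℤ.+-identityˡ _) (ℤ.*-zeroʳ (+ indicator b))
evaluate-jumps (suc d) b χ = begin
  (jump b c *ℤ + size (suc d) +ℤ value (jumps d c (χ ∘ left) ++ jumps d c (χ ∘ right)))
    +ℤ + indicator b *ℤ + size (suc d)
    ≡⟨ cong (λ v → (jump b c *ℤ + size (suc d) +ℤ v) +ℤ + indicator b *ℤ + size (suc d))
         (evaluate-++ (+_ ∘ size) (jumps d c (χ ∘ left)) _) ⟩
  (jump b c *ℤ + size (suc d) +ℤ (l +ℤ r)) +ℤ + indicator b *ℤ + size (suc d)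
    ≡⟨ regroup (+ indicator b) (+ indicator c) (+ size d) l r ⟩
  + indicator c +ℤ ((l +ℤ + indicator c *ℤ + size d) +ℤ (r +ℤ + indicator c *ℤ + size d))
    ≡⟨ cong₂ (λ m n → + indicator c +ℤ (m +ℤ n))
         (evaluate-jumps d c (χ ∘ left)) (evaluate-jumps d c (χ ∘ right)) ⟩
  + count (suc d) χ ∎
  where
  open ≡-Reasoning
  value = evaluate (+_ ∘ size)
  c = χ root
  l = value (jumps d c (χ ∘ left))
  r = value (jumps d c (χ ∘ right))
  regroup : ∀ b c s l r →
    ((c - b) *ℤ (1ℤ +ℤ (s +ℤ s)) +ℤ (l +ℤ r)) +ℤ b *ℤ (1ℤ +ℤ (s +ℤ s))
      ≡ c +ℤ ((l +ℤ c *ℤ s) +ℤ (r +ℤ c *ℤ s))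
  regroup = solve-∀

-- Bichromatic edges

orient : ∀ {A : Set} → Bool → Bool → A → A → List (A × A)
orient true  false u v = (u , v) ∷ []
orient false true  u v = (v , u) ∷ []
orient _     _     u v = []

length-orient : ∀ {A : Set} b c (u v : A) → length (orient b c u v) ≡ ∣ jump b c ∣
length-orient true  true  u v = refl
length-orient true  false u v = refl
length-orient false true  u v = refl
length-orient false false u v = refl

unique-orient : ∀ {A : Set} b c (u v : A) → Unique (orient b c u v)
unique-orient true  true  u v = []
unique-orient true  false u v = [] ∷ []
unique-orient false true  u v = [] ∷ []
unique-orient false false u v = []

all-orient : ∀ {A : Set} {P : A × A → Set} b c {u v : A} →
             (b ≡ true → c ≡ false → P (u , v)) → (b ≡ false → c ≡ true → P (v , u)) →
             All P (orient b c u v)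
all-orient true  true  p q = []
all-orient true  false p q = p refl refl ∷ []
all-orient false true  p q = q refl refl ∷ []
all-orient false false p q = []

both : ∀ {A B : Set} → (A → B) → A × A → B × B
both f (x , y) = f x , f y

both-injective : ∀ {A B : Set} {f : A → B} → (∀ {x y} → f x ≡ f y → x ≡ y) →
                 ∀ {e e′} → both f e ≡ both f e′ → e ≡ e′
both-injective inj eq = cong₂ _,_ (inj (,-injectiveˡ eq)) (inj (,-injectiveʳ eq))

-- The cut edges listed by the recursion of `jumps`, so that length and cost can be compared term by
-- term. Like the pairs in `cut`, each runs from a vertex coloured `true` to one coloured `false`.
bichromatic : ∀ d → (BVertex (suc d) → Bool) → List (BVertex (suc d) × BVertex (suc d))
branch : ∀ d → (BVertex (suc (suc d)) → Bool) → (BVertex (suc d) → BVertex (suc (suc d))) →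
         List (BVertex (suc (suc d)) × BVertex (suc (suc d)))

bichromatic zero    χ = []
bichromatic (suc d) χ = branch d χ left ++ branch d χ right

branch d χ side =
  orient (χ root) (χ (side root)) root (side root) ++ map (both side) (bichromatic d (χ ∘ side))

cost-jumps : ∀ d b χ →
  cost (jumps (suc d) b χ) ≡ ∣ jump b (χ root) ∣ + length (bichromatic d χ)
length-branch : ∀ d χ side →
  cost (jumps (suc d) (χ root) (χ ∘ side)) ≡ length (branch d χ side)

cost-jumps zero    b χ = refl
cost-jumps (suc d) b χ = cong (λ n → ∣ jump b (χ root) ∣ + n) (begin
  cost (ls ++ rs)
    ≡⟨ cost-++ ls rs ⟩
  cost ls + cost rs
    ≡⟨ cong₂ _+_ (length-branch d χ left) (length-branch d χ right) ⟩
  length (branch d χ left) + length (branch d χ right)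
    ≡⟨ length-++ (branch d χ left) ⟨
  length (bichromatic (suc d) χ) ∎)
  where
  open ≡-Reasoning
  ls = jumps (suc d) (χ root) (χ ∘ left)
  rs = jumps (suc d) (χ root) (χ ∘ right)

length-branch d χ side = begin
  cost (jumps (suc d) (χ root) (χ ∘ side))
    ≡⟨ cost-jumps d (χ root) (χ ∘ side) ⟩
  ∣ jump (χ root) (χ (side root)) ∣ + length below
    ≡⟨ cong₂ _+_ (sym (length-orient (χ root) (χ (side root)) root (side root)))
         (sym (length-map (both side) below)) ⟩
  length edge + length (map (both side) below)
    ≡⟨ length-++ edge ⟨
  length (branch d χ side) ∎
  where
  open ≡-Reasoning
  edge  = orient (χ root) (χ (side root)) root (side root)
  below = bichromatic d (χ ∘ side)

CutEdge : ∀ {d} → (BVertex d → Bool) → BVertex d × BVertex d → Set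
CutEdge χ (u , v) = χ u ≡ true × χ v ≡ false × (Parent u v ⊎ Parent v u)

cutEdge-bichromatic : ∀ d χ → All (CutEdge χ) (bichromatic d χ)
cutEdge-branch : ∀ d χ (side : BVertex (suc d) → BVertex (suc (suc d))) →
  Parent root (side root) → (∀ {u v} → Parent u v → Parent (side u) (side v)) →
  All (CutEdge χ) (branch d χ side)

cutEdge-bichromatic zero    χ = []
cutEdge-bichromatic (suc d) χ =
  All.++⁺ (cutEdge-branch d χ left root-left left) (cutEdge-branch d χ right root-right right)

cutEdge-branch d χ side top lift = All.++⁺
  (all-orient (χ root) (χ (side root))
    (λ χu χv → χu , χv , inj₁ top) (λ χu χv → χv , χu , inj₂ top))
  (All.map⁺ (All.map (λ (χu , χv , adj) → χu , χv , Sum.map lift lift adj)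
    (cutEdge-bichromatic d (χ ∘ side))))

disjoint : ∀ {A : Set} {P : A → Set} {xs ys : List A} →
           All P xs → All (¬_ ∘ P) ys → Disjoint xs ys
disjoint pxs ¬pys (x∈xs , x∈ys) = All.lookup ¬pys x∈ys (All.lookup pxs x∈xs)

data IsLeft : ∀ {d} → BVertex d → Set where
  left : ∀ {d} {v : BVertex d} → IsLeft (left v)

data IsRoot : ∀ {d} → BVertex d → Set where
  root : ∀ {d} → IsRoot (root {d})

TouchesRoot TouchesLeft : ∀ {d} → BVertex d × BVertex d → Set
TouchesRoot (u , v) = IsRoot u ⊎ IsRoot v
TouchesLeft (u , v) = IsLeft u ⊎ IsLeft v

-- Edges of the left branch have an endpoint in the left subtree, those of the right branch have
-- none. Within a branch, only the top edge touches the root.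
unique-bichromatic : ∀ d χ → Unique (bichromatic d χ)
unique-branch : ∀ d χ (side : BVertex (suc d) → BVertex (suc (suc d))) →
  (∀ {u v} → side u ≡ side v → u ≡ v) → (∀ {v} → ¬ IsRoot (side v)) →
  Unique (branch d χ side)

unique-bichromatic zero    χ = []
unique-bichromatic (suc d) χ = Unique.++⁺
  (unique-branch d χ left (λ { refl → refl }) λ ())
  (unique-branch d χ right (λ { refl → refl }) λ ())
  (disjoint touches misses)
  where
  touches : All TouchesLeft (branch d χ left)
  touches = All.++⁺
    (all-orient (χ root) (χ (left root)) (λ _ _ → inj₂ left) (λ _ _ → inj₁ left))
    (All.map⁺ (All.universal (λ _ → inj₁ left) _))
  misses : All (¬_ ∘ TouchesLeft) (branch d χ right)
  misses = All.++⁺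
    (all-orient (χ root) (χ (right root)) (λ _ _ → λ { (inj₁ ()) ; (inj₂ ()) })
      (λ _ _ → λ { (inj₁ ()) ; (inj₂ ()) }))
    (All.map⁺ (All.universal (λ _ → λ { (inj₁ ()) ; (inj₂ ()) }) _))

unique-branch d χ side inj ¬root = Unique.++⁺
  (unique-orient (χ root) (χ (side root)) root (side root))
  (Unique.map⁺ (both-injective inj) (unique-bichromatic d (χ ∘ side)))
  (disjoint {P = TouchesRoot}
    (all-orient (χ root) (χ (side root)) (λ _ _ → inj₁ root) (λ _ _ → inj₂ root))
    (All.map⁺ (All.universal (λ _ → [ ¬root , ¬root ]′) _)))

-- Cuts of the binary tree

-- Delete one occurrence of the head from `ys`; by uniqueness the tail of `xs` still lies in what
-- remains.
unique-⊆⇒length≤ : ∀ {A : Set} {xs ys : List A} →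
                   Unique xs → (∀ {x} → x ∈ xs → x ∈ ys) → length xs ≤ length ys
unique-⊆⇒length≤ []           xs⊆ys = z≤n
unique-⊆⇒length≤ {xs = x ∷ xs} (x∉xs ∷ uniq) xs⊆ys with ∈-∃++ (xs⊆ys (here refl))
... | as , bs , refl = begin
  suc (length xs)               ≤⟨ s≤s (unique-⊆⇒length≤ uniq avoid) ⟩
  suc (length (as ++ bs))       ≡⟨ cong suc (length-++ as) ⟩
  suc (length as + length bs)   ≡⟨ +-suc (length as) (length bs) ⟨
  length as + suc (length bs)   ≡⟨ length-++ as ⟨
  length (as ++ x ∷ bs)         ∎
  where
  open ≤-Reasoning
  avoid : ∀ {y} → y ∈ xs → y ∈ as ++ bs
  avoid y∈xs with ∈-++⁻ as (xs⊆ys (there y∈xs))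
  ... | inj₁ y∈as         = ∈-++⁺ˡ y∈as
  ... | inj₂ (here refl)  = case All.lookup x∉xs y∈xs refl of λ ()
  ... | inj₂ (there y∈bs) = ∈-++⁺ʳ as y∈bs

colour : ∀ d → Subset (size d) → BVertex d → Bool
colour d X v = lookup X (fromVertex d v)

count-cong : ∀ d {χ χ′ : BVertex d → Bool} → (∀ v → χ v ≡ χ′ v) → count d χ ≡ count d χ′
count-cong zero    χ≗χ′ = refl
count-cong (suc d) χ≗χ′ = cong₂ _+_ (cong indicator (χ≗χ′ root))
  (cong₂ _+_ (count-cong d (χ≗χ′ ∘ left)) (count-cong d (χ≗χ′ ∘ right)))

card-∷ : ∀ {n} b (X : Subset n) → card (b ∷ᵥ X) ≡ indicator b + card X
card-∷ true  X = refl
card-∷ false X = refl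

card-++ : ∀ {m n} (X : Subset m) (Y : Subset n) → card (X ++ᵥ Y) ≡ card X + card Y
card-++ []ᵥ          Y = refl
card-++ (true  ∷ᵥ X) Y = cong suc (card-++ X Y)
card-++ (false ∷ᵥ X) Y = card-++ X Y

card≡count : ∀ d (X : Subset (size d)) → card X ≡ count d (colour d X)
card≡count zero    []ᵥ = refl
-- `fromVertex` numbers the root first, then the left subtree, then the right one.
card≡count (suc d) (b ∷ᵥ X) with splitAt (size d) X
... | L , R , refl = begin
  card (b ∷ᵥ L ++ᵥ R)                 ≡⟨ card-∷ b (L ++ᵥ R) ⟩
  indicator b + card (L ++ᵥ R)        ≡⟨ cong (λ n → indicator b + n) (card-++ L R) ⟩
  indicator b + (card L + card R)     ≡⟨ cong₂ (λ m n → indicator b + (m + n)) l r ⟩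
  count (suc d) (colour (suc d) (b ∷ᵥ L ++ᵥ R)) ∎
  where
  open ≡-Reasoning
  l : card L ≡ count d (colour (suc d) (b ∷ᵥ L ++ᵥ R) ∘ left)
  l = trans (card≡count d L)
        (count-cong d λ v → sym (lookup-++ˡ L R (fromVertex d v)))
  r : card R ≡ count d (colour (suc d) (b ∷ᵥ L ++ᵥ R) ∘ right)
  r = trans (card≡count d R)
        (count-cong d λ v → sym (lookup-++ʳ L R (fromVertex d v)))

fromVertex-injective : ∀ d {u v} → fromVertex d u ≡ fromVertex d v → u ≡ v
fromVertex-injective d {u} {v} eq =
  trans (sym (to∘from d u)) (trans (cong (toVertex d) eq) (to∘from d v))

cutEdge⇒∈-cut : ∀ d X {e} → CutEdge (colour d X) e → both (fromVertex d) e ∈ cut (B d) X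
cutEdge⇒∈-cut d X {u , v} (u∈X , v∉X , adj) =
  ∈-filter⁺ _ (∈-cartesianProduct⁺ (∈-allFin _) (∈-allFin _))
    ( lookup⇒[]= (fromVertex d u) X u∈X
    , x∉p⇒x∈∁p (λ v∈X → case trans (sym ([]=⇒lookup v∈X)) v∉X of λ ())
    , subst₂ (Graph.Adj (B d)) (sym (to∘from d u)) (sym (to∘from d v)) adj )

length-bichromatic≤cutSize : ∀ d X →
  length (bichromatic d (colour (suc d) X)) ≤ cutSize (B (suc d)) X
length-bichromatic≤cutSize d X = begin
  length edges                                  ≡⟨ length-map (both (fromVertex (suc d))) edges ⟨
  length (map (both (fromVertex (suc d))) edges)
    ≤⟨ unique-⊆⇒length≤
         (Unique.map⁺ (both-injective (fromVertex-injective (suc d))) (unique-bichromatic d _))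
         (All.lookup (All.map⁺ (All.map (cutEdge⇒∈-cut (suc d) X) (cutEdge-bichromatic d _)))) ⟩
  cutSize (B (suc d)) X                         ∎
  where
  open ≤-Reasoning
  edges = bichromatic d (colour (suc d) X)

cutSize-criticalSize : ∀ d m (X : Subset (size (suc d))) →
                       card X ≡ criticalSize m → m ≤ suc (cutSize (B (suc d)) X)
cutSize-criticalSize d m X ∣X∣≡ = begin
  m                                                ≤⟨ cost-criticalSize m ts value ⟩
  -- The imaginary parent of the root is coloured `false`, so the jumps evaluate to the cardinality
  -- of `X` itself; the jump at the root is the extra 1.
  cost ts                                          ≡⟨ cost-jumps d false χ ⟩
  ∣ jump false (χ root) ∣ + length (bichromatic d χ)
    ≤⟨ +-mono-≤ (jump≤1 (χ root)) (length-bichromatic≤cutSize d X) ⟩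
  suc (cutSize (B (suc d)) X)                      ∎
  where
  open ≤-Reasoning
  χ  = colour (suc d) X
  ts = jumps (suc d) false χ
  value : evaluate (+_ ∘ size) ts ≡ + criticalSize m
  value = trans (sym (ℤ.+-identityʳ _))
    (trans (evaluate-jumps (suc d) false χ)
      (cong +_ (trans (sym (card≡count (suc d) X)) ∣X∣≡)))
  jump≤1 : ∀ b → ∣ jump false b ∣ ≤ 1
  jump≤1 true  = ≤-refl
  jump≤1 false = z≤n

-- The lower bound on the peak

peak-bound : ∀ d m → 3 * suc m ≤ d → m ≤ peak (B d)
peak-bound (suc d) m 3m≤d = ≤-pred (begin
  suc m                            ≤⟨ cutSize-criticalSize d (suc m) X ∣X∣≡i ⟩
  suc (cutSize (B (suc d)) X)      ≡⟨ cong suc cut≡δ ⟩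
  suc (δ (B (suc d)) i)            ≤⟨ s≤s (peak-maximal (B (suc d)) 1≤i i≤size) ⟩
  suc (peak (B (suc d)))           ∎)
  where
  open ≤-Reasoning
  i = criticalSize (suc m)
  1≤i : 1 ≤ i
  1≤i = ≤-trans (s≤s z≤n) (m≤n+m (suc m) _)
  i≤size : i ≤ size (suc d)
  i≤size = ≤-trans (criticalSize≤size (suc m)) (size-mono 3m≤d)
  attained = δ-attained (B (suc d)) i≤size
  X = proj₁ attained
  ∣X∣≡i = proj₁ (proj₂ attained)
  cut≡δ = proj₂ (proj₂ attained)

theorem3p25 : ∀ (d : ℕ) → 1 ≤ d → + (d / 3) - + 1 ≤ℤ + peak (B d)
theorem3p25 d _ = bound (d / 3) (subst (_≤ d) (*-comm (d / 3) 3) (m/n*n≤m d 3))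
  where
  bound : ∀ m → 3 * m ≤ d → + m - + 1 ≤ℤ + peak (B d)
  -- For d < 3 the left-hand side is -1.
  bound zero    _   = -≤+
  bound (suc m) 3m≤ = +≤+ (peak-bound d m 3m≤)
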